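{- Let $n\geq 2$ and let $f=1^{x_{1}}0^{y_{1}}1^{x_{2}}0^{y_{2}}\cdots 1^{x_{n}}0^{y_{n}}$ with integers $x_i\geq 1$, $y_i\geq 1$ for $i=1,\ldots,n$. If $y_{1}\geq y_{n}+1$ and $x_{1}=x_{n}=1$, then $Q_{d}(f)\not\hookrightarrow Q_{d}$ for all $d\geq 2\sum_{i=2}^{n-1}x_{i}+2\sum_{i=1}^{n-1}y_{i}+y_{n}+2$ (an empty sum being $0$).
   Context: All strings are binary; $1^a$ (resp. $0^a$) denotes the string of $a$ consecutive ones (resp. zeros), and juxtaposition is concatenation. $Q_d$ is the $d$-dimensional hypercube: its vertices are the binary strings of length $d$, two being adjacent iff they differ in exactly one bit. A string $f$ is a factor of $\mu$ if $f$ appears as $|f|$ consecutive bits of $\mu$. The generalized Fibonacci cube $Q_d(f)$ is the subgraph of $Q_d$ induced by all strings of length $d$ that do not contain $f$ as a factor. A subgraph $H$ of a connected graph $G$ is an isometric subgraph, written $H\hookrightarrow G$ (and $H\not\hookrightarrow G$ otherwise), if $d_H(\mu,\nu)=d_G(\mu,\nu)$ for all $\mu,\nu\in V(H)$ (with $d_H=\infty$ for vertices in different components of $H$). -}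

module Defs where

open import Data.Bool.Base using (Bool; true; false)
open import Data.List.Base using (List; _++_; map; concatMap; replicate; applyUpTo)
open import Data.List.Relation.Binary.Infix.Heterogeneous using (Infix)
open import Data.Nat.Base using (ℕ; suc; _+_; _∸_; _≤_)
open import Data.Nat.ListAction using (sum)
open import Data.Product using (∃!; _×_; _,_; proj₁)
open import Data.Refinement using (Refinement; Refinement-syntax; value)
open import Data.Vec.Base using (Vec; lookup; toList)
open import Function.Base using (_on_)
open import Function.Bundles using (_⇔_)
open import Level using (0ℓ)
open import Relation.Binary.Core using (Rel)
open import Relation.Binary.PropositionalEquality using (_≡_; _≢_; refl; ≢-sym)
open import Relation.Nullary.Negation using (¬_)
open import Relation.Unary using (Pred)

record Graph : Set₁ where
  field
    Vertex     : Set
    Adj        : Rel Vertex 0ℓ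
    Adj-sym    : ∀ {u v} → Adj u v → Adj v u
    Adj-irrefl : ∀ {v} → ¬ Adj v v

open Graph public

infixr 5 _∷_

data Walk (G : Graph) : Vertex G → Vertex G → ℕ → Set where
  []  : ∀ {v} → Walk G v v 0
  _∷_ : ∀ {u v w k} → Adj G u v → Walk G v w k → Walk G u w (suc k)

-- d_G(u,v) = k for a natural number k.  Vertices in different components
-- satisfy this for no k, which encodes d_G(u,v) = ∞.
Dist : (G : Graph) → Vertex G → Vertex G → ℕ → Set
Dist G u v k = Walk G u v k × (∀ {m} → Walk G u v m → k ≤ m)

record Subgraph (G : Graph) : Set₁ where
  field
    IsVertex  : Pred (Vertex G) 0ℓ
    Edge      : Rel (Vertex G) 0ℓ
    Edge-sym  : ∀ {u v} → Edge u v → Edge v u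
    Edge⇒Adj  : ∀ {u v} → Edge u v → Adj G u v
    Edge⇒ends : ∀ {u v} → Edge u v → IsVertex u × IsVertex v

open Subgraph public

-- Refinement types carry their membership proof irrelevantly, so each vertex
-- of G gives rise to at most one vertex of the subgraph.
⟦_⟧ : ∀ {G} → Subgraph G → Graph
⟦_⟧ {G} H = record
  { Vertex     = [ v ∈ Vertex G ∣ IsVertex H v ]
  ; Adj        = Edge H on value
  ; Adj-sym    = Edge-sym H
  ; Adj-irrefl = λ e → Adj-irrefl G (Edge⇒Adj H e)
  }

induced : (G : Graph) → Pred (Vertex G) 0ℓ → Subgraph G
induced G P = record
  { IsVertex  = P
  ; Edge      = λ u v → (P u × P v) × Adj G u v
  ; Edge-sym  = λ { ((pu , pv) , e) → (pv , pu) , Adj-sym G e }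
  ; Edge⇒Adj  = λ { (_ , e) → e }
  ; Edge⇒ends = proj₁
  }

-- Equality of distances in ℕ ∪ {∞}, stated as: the two distances take the same
-- finite values.
IsIsometric : ∀ {G} → Subgraph G → Set
IsIsometric {G} H = ∀ (u v : Vertex ⟦ H ⟧) (k : ℕ) →
  Dist ⟦ H ⟧ u v k ⇔ Dist G (value u) (value v) k

Q : ℕ → Graph
Q d = record
  { Vertex     = Vec Bool d
  ; Adj        = λ u v → ∃! _≡_ λ i → lookup u i ≢ lookup v i
  ; Adj-sym    = λ { (i , differ , unique) →
                     i , ≢-sym differ , λ differ′ → unique (≢-sym differ′) }
  ; Adj-irrefl = λ { (_ , differ , _) → differ refl }
  }

_IsFactorOf_ : List Bool → List Bool → Set
_IsFactorOf_ = Infix _≡_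

Q[_]⟨_⟩ : (d : ℕ) → List Bool → Subgraph (Q d)
Q[ d ]⟨ f ⟩ = induced (Q d) λ μ → ¬ (f IsFactorOf toList μ)

-- The list a, a + 1, …, b, which is empty when b < a.
[_⋯_] : ℕ → ℕ → List ℕ
[ a ⋯ b ] = applyUpTo (a +_) (suc b ∸ a)

Σ[_⋯_] : ℕ → ℕ → (ℕ → ℕ) → ℕ
Σ[ a ⋯ b ] g = sum (map g [ a ⋯ b ])

1^_ 0^_ : ℕ → List Bool
1^ a = replicate a true
0^ a = replicate a false

-- 1^{x₁} 0^{y₁} ⋯ 1^{xₙ} 0^{yₙ}; only the values of x and y at 1, …, n matter.
blocks : ℕ → (x y : ℕ → ℕ) → List Bool
blocks n x y = concatMap (λ i → 1^ (x i) ++ 0^ (y i)) [ 1 ⋯ n ]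

{-# OPTIONS --safe #-}
module Submission where

-- Put q = yₙ and f = c 0^q.  Since x₁ = xₙ = 1 and y₁ > q, c = A 0 1 = 1 0 D where
-- D begins with 0^q.  The words 0^k A 0 0 D 0^q and 0^k A 1 1 D 0^q are at distance 2
-- in the cube, and both of their common neighbours contain f: A 0 1 D 0^q begins
-- with f, and A 1 0 D 0^q ends with it.  Neither word itself contains f, by a parity
-- count of ones, so their distance in Q_d(f) is not 2.

open import Data.Bool.Base using (Bool; true; false; _xor_)
open import Data.Bool.Properties using (xor-assoc; _≟_)
open import Data.Empty using (⊥; ⊥-elim)
open import Data.Fin.Base using (zero; suc)
open import Data.Fin.Properties as Fin using ()
open import Data.Irrelevant using ([_])
open import Data.List.Base
  using (List; []; _∷_; _++_; _∷ʳ_; length; replicate; map; concatMap; foldr; applyUpTo)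
open import Data.List.Properties
  using (++-assoc; ++-identityʳ; length-++; length-++-≤ˡ; length-++-≤ʳ; length-replicate;
         ∷-injective; concatMap-++; applyUpTo-∷ʳ)
open import Data.List.Relation.Binary.Infix.Heterogeneous
  using (here; there; toView; fromView; MkView; _++ⁱ_)
open import Data.List.Relation.Binary.Pointwise using (Pointwise-≡⇒≡; ≡⇒Pointwise-≡)
open import Data.List.Relation.Binary.Prefix.Heterogeneous using (_∷_)
open import Data.Nat.Base using (ℕ; zero; suc; _+_; _*_; _∸_; _≤_; _≥_; z≤n; s≤s)
open import Data.Nat.ListAction using (sum)
open import Data.Nat.Properties
  using (+-comm; +-cancelˡ-≡; +-cancelʳ-≡; ≤-reflexive; ≤-trans; n≤1+n; 1+n≰n; m≤n⇒∃[o]m+o≡n)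
open import Data.Nat.Tactic.RingSolver using (solve-∀)
open import Data.Product using (∃; _×_; _,_)
open import Data.Refinement using (_,_)
open import Data.Sum using (_⊎_; inj₁; inj₂)
open import Data.Vec.Base as Vec using (Vec; []; _∷_; lookup; fromList; toList)
open import Data.Vec.Properties
  using (tabulate∘lookup; tabulate-cong; ∷-injectiveˡ; ++-injectiveʳ; toList-++; toList∘fromList)
open import Function.Base using (_∘_)
open import Function.Bundles using (Equivalence)
open import Relation.Binary.PropositionalEquality
open import Relation.Nullary.Decidable using (decidable-stable)
open import Relation.Nullary.Negation using (¬_; contradiction)
open import Defs

private variable
  B : Set
  d m : ℕ

-- Words

-- Levi's lemma on two factorizations of one word. The bound on the suffixes decides which cut lies
-- further right; a nonempty `u` against an empty `w` would make `z` longer than `v`.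
levi : ∀ (u w : List B) {v z} → length z ≤ length v → u ++ v ≡ w ++ z →
       ∃ λ r → w ≡ u ++ r × v ≡ r ++ z
levi []      w       z≤v eq   = w , refl , eq
levi (a ∷ u) []  {v} z≤v refl =
  contradiction (≤-trans (s≤s (length-++-≤ʳ v {u})) z≤v) 1+n≰n
levi (a ∷ u) (b ∷ w) z≤v eq
  with refl , eq′ ← ∷-injective eq
  with r , refl , v≡ ← levi u w z≤v eq′ = r , refl , v≡

replicate-+ : ∀ m n (a : B) → replicate (m + n) a ≡ replicate m a ++ replicate n a
replicate-+ zero    n a = refl
replicate-+ (suc m) n a = cong (a ∷_) (replicate-+ m n a)

replicate-∷ʳ : ∀ n (a : B) → replicate (suc n) a ≡ replicate n a ∷ʳ a
replicate-∷ʳ zero    a = refl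
replicate-∷ʳ (suc n) a = cong (a ∷_) (replicate-∷ʳ n a)

factor-split : ∀ {f w} → f IsFactorOf w → ∃ λ u → ∃ λ v → w ≡ u ++ f ++ v
factor-split p with MkView u q v ← toView p with refl ← Pointwise-≡⇒≡ q = u , v , refl

factor-++ : ∀ u f v → f IsFactorOf (u ++ f ++ v)
factor-++ u f v = fromView (MkView u (≡⇒Pointwise-≡ refl) v)

-- An occurrence starting with 1 cannot start inside the zeros, so padding on the left creates no
-- new occurrence.
factor-dropˡ : ∀ k {f w} → (true ∷ f) IsFactorOf (0^ k ++ w) → (true ∷ f) IsFactorOf w
factor-dropˡ zero    p               = p
factor-dropˡ (suc k) (here (() ∷ _))
factor-dropˡ (suc k) (there p)       = factor-dropˡ k p

-- At least |s| letters follow the copy of `c`, so this copy ends inside `w`.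
factor-dropʳ : ∀ {c w} s → (c ++ s) IsFactorOf (w ++ s) →
               ∃ λ u → ∃ λ v → w ≡ u ++ c ++ v
factor-dropʳ {c} {w} s p
  with u , v , eq ← factor-split p
  with r , refl , _ ← levi (u ++ c) w {s ++ v} {s} (length-++-≤ˡ s)
         (trans (++-assoc u c (s ++ v)) (trans (cong (u ++_) (sym (++-assoc c s v))) (sym eq)))
  = u , r , ++-assoc u c r

-- Since `c` is as long as `w ++ D`, the part left over on the right matches the shift `a` on the
-- left. In `no-occurrence`, `a` is a suffix of A and |A| = |D|, so `v` is short enough for `levi`
-- to split it off D.
length-cancel : ∀ (a : List B) {c v w D} → length c ≡ length w + length D →
  c ++ v ≡ a ++ w ++ D → length v ≡ length a
length-cancel a {c} {v} {w} {D} |c|≡|wD| eq = +-cancelʳ-≡ (length w + length D) _ _ (begin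
  length v + (length w + length D)   ≡⟨ cong (length v +_) |c|≡|wD| ⟨
  length v + length c                ≡⟨ +-comm (length v) _ ⟩
  length c + length v                ≡⟨ length-++ c ⟨
  length (c ++ v)                    ≡⟨ cong length eq ⟩
  length (a ++ w ++ D)               ≡⟨ length-++ a ⟩
  length a + length (w ++ D)         ≡⟨ cong (length a +_) (length-++ w) ⟩
  length a + (length w + length D)   ∎)
  where open ≡-Reasoning

-- Parity of the number of ones

parity : List Bool → Bool
parity = foldr _xor_ false

parity-++ : ∀ u v → parity (u ++ v) ≡ parity u xor parity v
parity-++ []      v = refl
parity-++ (a ∷ u) v =
  trans (cong (a xor_) (parity-++ u v)) (sym (xor-assoc a (parity u) (parity v)))

-- Modulo 2 the first equation gives b = c + 1 and the second b = c.
parity-clash : ∀ a b c → a xor b ≡ c xor (a xor true) → true xor b ≡ c xor true → ⊥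
parity-clash true  true  true  () _
parity-clash true  true  false _ ()
parity-clash true  false true  _ ()
parity-clash true  false false () _
parity-clash false true  true  () _
parity-clash false true  false _ ()
parity-clash false false true  _ ()
parity-clash false false false () _

parity-double : ∀ a e b → parity (a ++ e ∷ e ∷ b) ≡ parity a xor parity b
-- Two negations of `parity b` cancel by computation only once its value is known.
parity-double a true  b with parity b in eq
... | true  rewrite parity-++ a (true ∷ true ∷ b) | eq = refl
... | false rewrite parity-++ a (true ∷ true ∷ b) | eq = refl
parity-double a false b = parity-++ a (false ∷ false ∷ b)

-- If `a` is empty, `r` is 01. Otherwise `r` is 10: if `a` is a single letter, it is 1 and the 0 of
-- 01 follows it; if longer, `a` itself begins with 10.
boundary-parity : ∀ a e {b D} r v → length r ≡ 2 →
  true ∷ false ∷ D ≡ a ++ e ∷ e ∷ b → a ++ false ∷ true ∷ [] ≡ r ++ v →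
  parity r ≡ true
boundary-parity []          e (_ ∷ _ ∷ []) v _ _    refl = refl
boundary-parity (_ ∷ [])    e (_ ∷ _ ∷ []) v _ refl refl = refl
boundary-parity (_ ∷ _ ∷ _) e (_ ∷ _ ∷ []) v _ refl refl = refl

-- An occurrence after u matches c = a e e b with A = u a and D = b v.  Comparing
-- c = u (a 0 1) with c = (1 0 b) v gives 1 0 b = u r with |r| = 2; one of the two
-- letters of r is 1, so u and b have equally many ones mod 2, whereas
-- c = a e e b = u a 0 1 says the opposite.
no-occurrence : ∀ A D e → A ++ false ∷ true ∷ [] ≡ true ∷ false ∷ D →
  ∀ u v → A ++ e ∷ e ∷ D ≢ u ++ (true ∷ false ∷ D) ++ v
no-occurrence A D e A01≡10D u v eq
  with |A|≡|D| ← +-cancelʳ-≡ 2 (length A) (length D)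
         (trans (sym (length-++ A)) (trans (cong length A01≡10D) (+-comm 2 (length D))))
  with a , refl , eq₁ ← levi u A {true ∷ false ∷ D ++ v} {e ∷ e ∷ D}
         (s≤s (s≤s (length-++-≤ˡ D))) (sym eq)
  with |v|≡|a| ← length-cancel a {true ∷ false ∷ D} {v} {e ∷ e ∷ []} {D} refl eq₁
  with b , c≡ , refl ← levi (a ++ e ∷ e ∷ []) (true ∷ false ∷ D) {D} {v}
         (≤-trans (≤-reflexive |v|≡|a|) (≤-trans (length-++-≤ʳ a {u}) (≤-reflexive |A|≡|D|)))
         (trans (++-assoc a (e ∷ e ∷ []) D) (sym eq₁))
  with r , 10b≡ur , a01≡rv ← levi u (true ∷ false ∷ b) {a ++ false ∷ true ∷ []} {v}
         (≤-trans (≤-reflexive |v|≡|a|) (length-++-≤ˡ a))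
         (trans (sym (++-assoc u a _)) A01≡10D)
  = parity-clash (parity a) (parity b) (parity u)
      (begin
        parity a xor parity b                      ≡⟨ parity-double a e b ⟨
        parity (a ++ e ∷ e ∷ b)                    ≡⟨ cong parity c≡aeeb ⟨
        parity (true ∷ false ∷ b ++ v)             ≡⟨ cong parity A01≡10D ⟨
        parity ((u ++ a) ++ false ∷ true ∷ [])     ≡⟨ cong parity (++-assoc u a _) ⟩
        parity (u ++ a ++ false ∷ true ∷ [])       ≡⟨ parity-++ u _ ⟩
        parity u xor parity (a ++ false ∷ true ∷ [])  ≡⟨ cong (parity u xor_) (parity-++ a _) ⟩
        parity u xor (parity a xor true)           ∎)
      (begin
        true xor parity b                          ≡⟨ cong parity 10b≡ur ⟩
        parity (u ++ r)                            ≡⟨ parity-++ u r ⟩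
        parity u xor parity r                      ≡⟨ cong (parity u xor_) (boundary-parity a e r v |r|≡2 c≡aeeb a01≡rv) ⟩
        parity u xor true                          ∎)
  where
  open ≡-Reasoning
  c≡aeeb = trans c≡ (++-assoc a (e ∷ e ∷ []) b)
  |r|≡2 : length r ≡ 2
  |r|≡2 = +-cancelʳ-≡ (length a) _ _ (begin
    length r + length a            ≡⟨ cong (length r +_) |v|≡|a| ⟨
    length r + length v            ≡⟨ length-++ r ⟨
    length (r ++ v)                ≡⟨ cong length a01≡rv ⟨
    length (a ++ false ∷ true ∷ [])  ≡⟨ length-++ a ⟩
    length a + 2                   ≡⟨ +-comm (length a) 2 ⟩
    2 + length a                   ∎)

-- The hypercube

Adj-here : ∀ {a b} (u : Vec Bool d) → a ≢ b → Adj (Q (suc d)) (a ∷ u) (b ∷ u)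
Adj-here u a≢b = zero , a≢b ,
  λ { {zero} _ → refl ; {suc i} u≢u → contradiction refl u≢u }

Adj-++ : ∀ (p : Vec Bool m) {u v : Vec Bool d} →
         Adj (Q d) u v → Adj (Q (m + d)) (p Vec.++ u) (p Vec.++ v)
Adj-++ []      e = e
Adj-++ (a ∷ p) e with i , u≢v , unique ← Adj-++ p e =
  suc i , u≢v ,
  λ { {zero} a≢a → contradiction refl a≢a ; {suc j} u≢v′ → cong suc (unique u≢v′) }

lookup-ext : ∀ (u v : Vec B d) → (∀ i → lookup u i ≡ lookup v i) → u ≡ v
lookup-ext u v eq =
  trans (sym (tabulate∘lookup u)) (trans (tabulate-cong eq) (tabulate∘lookup v))

-- Uniqueness of the differing index only refutes inequality at the other positions; decidability of
-- equality of bits turns this into equality.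
Adj-∷⁻ : ∀ {a b} (u v : Vec Bool d) → Adj (Q (suc d)) (a ∷ u) (b ∷ v) →
         (a ≢ b × u ≡ v) ⊎ (a ≡ b × Adj (Q d) u v)
Adj-∷⁻ u v (zero , a≢b , unique) = inj₁ (a≢b , lookup-ext u v λ i →
  decidable-stable (lookup u i ≟ lookup v i) λ u≢v → contradiction (unique {suc i} u≢v) λ ())
Adj-∷⁻ {a = a} {b} u v (suc i , u≢v , unique) = inj₂
  ( decidable-stable (a ≟ b) (λ a≢b → contradiction (unique {zero} a≢b) λ ())
  , i , u≢v , λ u≢v′ → Fin.suc-injective (unique u≢v′))

Adj-++⁻ : ∀ (p : Vec Bool m) {u v : Vec Bool d} →
          Adj (Q (m + d)) (p Vec.++ u) (p Vec.++ v) → Adj (Q d) u v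
Adj-++⁻ []      e = e
Adj-++⁻ (a ∷ p) e with Adj-∷⁻ _ _ e
... | inj₁ (a≢a , _) = contradiction refl a≢a
... | inj₂ (_ , e′)  = Adj-++⁻ p e′

-- The endpoints agree on `p`, so a step that changes a letter of `p` must be undone by the other
-- step, which would force `u` = `v`.
common-neighbour-++ : ∀ (p : Vec Bool m) {u v : Vec Bool d} w → u ≢ v →
  Adj (Q (m + d)) (p Vec.++ u) w → Adj (Q (m + d)) w (p Vec.++ v) →
  ∃ λ w′ → w ≡ p Vec.++ w′ × Adj (Q d) u w′ × Adj (Q d) w′ v
common-neighbour-++ []      w       u≢v e e′ = w , refl , e , e′
common-neighbour-++ (a ∷ p) (b ∷ w) u≢v e e′ with Adj-∷⁻ _ _ e | Adj-∷⁻ _ _ e′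
... | inj₁ (_ , pu≡w)   | inj₁ (_ , w≡pv)   =
  contradiction (++-injectiveʳ p p (trans pu≡w w≡pv)) u≢v
... | inj₁ (a≢b , _)    | inj₂ (b≡a , _)    = contradiction (sym b≡a) a≢b
... | inj₂ (a≡b , _)    | inj₁ (b≢a , _)    = contradiction (sym a≡b) b≢a
... | inj₂ (refl , e₁)  | inj₂ (_ , e₁′)
  with w′ , refl , f , f′ ← common-neighbour-++ p w u≢v e₁ e₁′ = w′ , refl , f , f′

-- Exactly one of the two steps flips the first bit, so the other flips the second; the order of the
-- flips gives the two cases.
common-neighbour : ∀ {a a′ b b′} (t : Vec Bool d) w → a ≢ a′ → b ≢ b′ →
  Adj (Q (2 + d)) (a ∷ b ∷ t) w → Adj (Q (2 + d)) w (a′ ∷ b′ ∷ t) →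
  w ≡ a ∷ b′ ∷ t ⊎ w ≡ a′ ∷ b ∷ t
common-neighbour t (c ∷ w) a≢a′ b≢b′ e e′ with Adj-∷⁻ _ _ e | Adj-∷⁻ _ _ e′
... | inj₁ (_ , refl) | inj₁ (_ , refl)   = contradiction refl b≢b′
... | inj₁ (_ , refl) | inj₂ (refl , _)   = inj₂ refl
... | inj₂ (refl , _) | inj₁ (_ , refl)   = inj₁ refl
... | inj₂ (refl , _) | inj₂ (a≡a′ , _)   = contradiction a≡a′ a≢a′

-- Distance two and the failure of isometry

Walk₀⇒≡ : ∀ {G u v} → Walk G u v 0 → u ≡ v
Walk₀⇒≡ [] = refl

Walk₁⇒Adj : ∀ {G u v} → Walk G u v 1 → Adj G u v
Walk₁⇒Adj (e ∷ []) = e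

Dist-two : ∀ {a a′ b b′} (p : Vec Bool m) (t : Vec Bool d) → a ≢ a′ → b ≢ b′ →
  Dist (Q (m + (2 + d))) (p Vec.++ a ∷ b ∷ t) (p Vec.++ a′ ∷ b′ ∷ t) 2
Dist-two {a = a} {a′} {b} {b′} p t a≢a′ b≢b′ =
  _∷_ {v = p Vec.++ a′ ∷ b ∷ t}
    (Adj-++ p {a ∷ b ∷ t} {a′ ∷ b ∷ t} (Adj-here (b ∷ t) a≢a′))
    (Adj-++ p {a′ ∷ b ∷ t} {a′ ∷ b′ ∷ t}
       (Adj-++ (a′ ∷ []) {b ∷ t} {b′ ∷ t} (Adj-here t b≢b′)) ∷ []) ,
  λ { {zero} walk → contradiction (∷-injectiveˡ (++-injectiveʳ p p (Walk₀⇒≡ walk))) a≢a′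
    ; {suc zero} walk → ⊥-elim (nonadjacent (Adj-++⁻ p (Walk₁⇒Adj walk)))
    ; {suc (suc _)} _ → s≤s (s≤s z≤n) }
  where
  nonadjacent : ¬ Adj (Q _) (a ∷ b ∷ t) (a′ ∷ b′ ∷ t)
  nonadjacent e with Adj-∷⁻ _ _ e
  ... | inj₁ (_ , refl) = b≢b′ refl
  ... | inj₂ (a≡a′ , _) = a≢a′ a≡a′

-- Isometry would give a walk of length 2 inside the subgraph, but its middle vertex is one of the
-- two other corners of the square, and both contain `f`.
square-not-isometric : ∀ {a a′ b b′} (p : Vec Bool m) (t : Vec Bool d) f →
  a ≢ a′ → b ≢ b′ →
  ¬ f IsFactorOf toList (p Vec.++ a ∷ b ∷ t) →
  ¬ f IsFactorOf toList (p Vec.++ a′ ∷ b′ ∷ t) →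
  f IsFactorOf toList (p Vec.++ a ∷ b′ ∷ t) →
  f IsFactorOf toList (p Vec.++ a′ ∷ b ∷ t) →
  ¬ IsIsometric Q[ m + (2 + d) ]⟨ f ⟩
square-not-isometric p t f a≢a′ b≢b′ f∉ab f∉a′b′ f∈ab′ f∈a′b isometric
  -- Vertices carry their membership proofs irrelevantly; the usable proof that the middle vertex
  -- avoids `f` comes from the edge.
  with (((_ , f∉w) , e) ∷ (_ , e′) ∷ []) , _ ←
    Equivalence.from (isometric (_ , [ f∉ab ]) (_ , [ f∉a′b′ ]) 2) (Dist-two p t a≢a′ b≢b′)
  with w , w≡ , e₁ , e₁′ ← common-neighbour-++ p _ (a≢a′ ∘ ∷-injectiveˡ) e e′
  with common-neighbour t w a≢a′ b≢b′ e₁ e₁′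
... | inj₁ refl = f∉w (subst (λ w → f IsFactorOf toList w) (sym w≡) f∈ab′)
... | inj₂ refl = f∉w (subst (λ w → f IsFactorOf toList w) (sym w≡) f∈a′b)

-- All that is needed of the block structure is that c = A 0 1 also reads 1 0 followed by `0^ q`.
-- Here `k` is the length of the padding, which reaches the larger dimensions.
overlap-not-isometric : ∀ A D q k → A ++ false ∷ true ∷ [] ≡ true ∷ false ∷ (0^ q ++ D) →
  ¬ IsIsometric Q[ k + length A + (2 + (length (0^ q ++ D) + q)) ]⟨ A ++ false ∷ true ∷ 0^ q ⟩
overlap-not-isometric A D′ q k A01≡10D =
  subst (λ n → ¬ IsIsometric Q[ n ]⟨ f ⟩)
    (cong₂ (λ i j → i + (2 + j)) length-P (trans (length-++ D) (cong (length D +_) (length-replicate q))))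
    (square-not-isometric (fromList P) (fromList T) f (λ ()) (λ ())
      (avoids false) (avoids true) (contains false true f∈01) (contains true false f∈10))
  where
  D P T f : List Bool
  D = 0^ q ++ D′
  P = 0^ k ++ A
  T = D ++ 0^ q
  f = A ++ false ∷ true ∷ 0^ q
  length-P : length P ≡ k + length A
  length-P = trans (length-++ (0^ k)) (cong (_+ length A) (length-replicate k))
  as-list : ∀ a b → toList (fromList P Vec.++ a ∷ b ∷ fromList T) ≡ 0^ k ++ A ++ a ∷ b ∷ T
  as-list a b = trans (toList-++ (fromList P) _)
    (trans (cong₂ (λ p t → p ++ a ∷ b ∷ t) (toList∘fromList P) (toList∘fromList T))
      (++-assoc (0^ k) A _))
  f≡10D0 : f ≡ true ∷ false ∷ (D ++ 0^ q)
  f≡10D0 = trans (sym (++-assoc A (false ∷ true ∷ []) (0^ q))) (cong (_++ 0^ q) A01≡10D)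
  avoids : ∀ e → ¬ f IsFactorOf toList (fromList P Vec.++ e ∷ e ∷ fromList T)
  avoids e p
    -- After removing the padding, the final `0^ q` is cancelled from both the factor and the word,
    -- leaving an occurrence of c in A e e D.
    with u , v , eq ← factor-dropʳ {true ∷ false ∷ D} (0^ q)
      (subst ((true ∷ false ∷ D ++ 0^ q) IsFactorOf_) (sym (++-assoc A (e ∷ e ∷ D) (0^ q)))
        (factor-dropˡ k (subst₂ _IsFactorOf_ f≡10D0 (as-list e e) p)))
    = no-occurrence A D e A01≡10D u v eq
  contains : ∀ a b → f IsFactorOf (A ++ a ∷ b ∷ T) →
             f IsFactorOf toList (fromList P Vec.++ a ∷ b ∷ fromList T)
  contains a b p = subst (f IsFactorOf_) (sym (as-list a b)) (0^ k ++ⁱ p)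
  -- The zeros at the start of `D` complete A 0 1 to `f`.
  f∈01 : f IsFactorOf (A ++ false ∷ true ∷ T)
  f∈01 = subst (f IsFactorOf_)
    (trans (++-assoc A _ (D′ ++ 0^ q))
      (cong (λ t → A ++ false ∷ true ∷ t) (sym (++-assoc (0^ q) D′ (0^ q)))))
    (factor-++ [] f (D′ ++ 0^ q))
  f∈10 : f IsFactorOf (A ++ true ∷ false ∷ T)
  f∈10 = subst (λ g → f IsFactorOf (A ++ g)) (trans (++-identityʳ f) f≡10D0) (factor-++ A f [])

-- Block words

-- By definition `blocks` unfolds at its first block; this unfolds it at the last one, where A 0 1
-- is read off.
blocks-suc : ∀ n x y → blocks (suc n) x y ≡ blocks n x y ++ 1^ (x (suc n)) ++ 0^ (y (suc n))
blocks-suc n x y = begin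
  concatMap block (applyUpTo suc (suc n))               ≡⟨ cong (concatMap block) (applyUpTo-∷ʳ suc n) ⟨
  concatMap block (applyUpTo suc n ∷ʳ suc n)            ≡⟨ concatMap-++ block (applyUpTo suc n) (suc n ∷ []) ⟩
  blocks n x y ++ block (suc n) ++ []                   ≡⟨ cong (blocks n x y ++_) (++-identityʳ _) ⟩
  blocks n x y ++ block (suc n)                         ∎
  where
  open ≡-Reasoning
  block : ℕ → List Bool
  block i = 1^ (x i) ++ 0^ (y i)

length-concat-blocks : ∀ (x y : ℕ → ℕ) is →
  length (concatMap (λ i → 1^ (x i) ++ 0^ (y i)) is) ≡ sum (map x is) + sum (map y is)
length-concat-blocks x y []       = refl
length-concat-blocks x y (i ∷ is) = begin
  length ((1^ (x i) ++ 0^ (y i)) ++ rest)                     ≡⟨ length-++ (1^ (x i) ++ 0^ (y i)) ⟩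
  length (1^ (x i) ++ 0^ (y i)) + length rest                 ≡⟨ cong₂ _+_ (length-++ (1^ (x i))) (length-concat-blocks x y is) ⟩
  length (1^ (x i)) + length (0^ (y i)) + (sum (map x is) + sum (map y is))
    ≡⟨ cong₂ (λ j k → j + k + (sum (map x is) + sum (map y is))) (length-replicate (x i)) (length-replicate (y i)) ⟩
  x i + y i + (sum (map x is) + sum (map y is))               ≡⟨ interchange (x i) (y i) _ _ ⟩
  x i + sum (map x is) + (y i + sum (map y is))               ∎
  where
  open ≡-Reasoning
  rest = concatMap (λ i → 1^ (x i) ++ 0^ (y i)) is
  interchange : ∀ a b c d → a + b + (c + d) ≡ a + c + (b + d)
  interchange = solve-∀

lemma2p5 : (n : ℕ) → n ≥ 2 → (x y : ℕ → ℕ) →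
    (∀ i → 1 ≤ i → i ≤ n → x i ≥ 1) →
    (∀ i → 1 ≤ i → i ≤ n → y i ≥ 1) →
    y 1 ≥ y n + 1 → x 1 ≡ 1 → x n ≡ 1 →
    (d : ℕ) →
    d ≥ 2 * Σ[ 2 ⋯ n ∸ 1 ] x + 2 * Σ[ 1 ⋯ n ∸ 1 ] y + y n + 2 →
    ¬ IsIsometric Q[ d ]⟨ blocks n x y ⟩
lemma2p5 (suc (suc n)) (s≤s (s≤s z≤n)) x y _ y≥1 y₁>yₙ x₁≡1 xₙ≡1 d d≥
  -- `k` is the excess of the dimension over the bound; `j` counts the zeros of the first block
  -- beyond the one in 10 and the q that follow; `l` leaves out the last zero of the next-to-last
  -- block, which is the 0 of A 0 1.
  with k , refl ← m≤n⇒∃[o]m+o≡n d≥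
  with j , yₙ+1+j≡y₁ ← m≤n⇒∃[o]m+o≡n y₁>yₙ
  with l , 1+l≡yₗ ← m≤n⇒∃[o]m+o≡n (y≥1 (suc n) (s≤s z≤n) (n≤1+n (suc n)))
  = subst₂ (λ d f → ¬ IsIsometric Q[ d ]⟨ f ⟩) d≡ (sym f≡)
      (overlap-not-isometric A D q k A01≡10D)
  where
  open ≡-Reasoning
  q : ℕ
  q = y (suc (suc n))
  M A D : List Bool
  M = concatMap (λ i → 1^ (x i) ++ 0^ (y i)) [ 2 ⋯ suc n ]
  A = blocks n x y ++ 1^ (x (suc n)) ++ 0^ l
  D = 0^ j ++ M ++ true ∷ []
  -- The word without its last block is split at its right end here and at its left end in
  -- `init≡10`. If it is a single block, `M` is empty and both splits cut that block.
  init≡A0 : blocks (suc n) x y ≡ A ++ false ∷ []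
  init≡A0 = begin
    blocks (suc n) x y                                        ≡⟨ blocks-suc n x y ⟩
    blocks n x y ++ 1^ (x (suc n)) ++ 0^ (y (suc n))          ≡⟨ cong (λ i → blocks n x y ++ 1^ (x (suc n)) ++ 0^ i) 1+l≡yₗ ⟨
    blocks n x y ++ 1^ (x (suc n)) ++ 0^ (suc l)              ≡⟨ cong (λ z → blocks n x y ++ 1^ (x (suc n)) ++ z) (replicate-∷ʳ l false) ⟩
    blocks n x y ++ 1^ (x (suc n)) ++ 0^ l ++ false ∷ []      ≡⟨ cong (blocks n x y ++_) (++-assoc (1^ (x (suc n))) (0^ l) _) ⟨
    blocks n x y ++ (1^ (x (suc n)) ++ 0^ l) ++ false ∷ []    ≡⟨ ++-assoc (blocks n x y) _ _ ⟨
    A ++ false ∷ []                                           ∎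
  init≡10 : blocks (suc n) x y ≡ true ∷ false ∷ (0^ q ++ 0^ j ++ M)
  init≡10 = begin
    (1^ (x 1) ++ 0^ (y 1)) ++ M              ≡⟨ cong₂ (λ i i′ → (1^ i ++ 0^ i′) ++ M) x₁≡1 (sym yₙ+1+j≡y₁) ⟩
    true ∷ 0^ (q + 1 + j) ++ M               ≡⟨ cong (λ i → true ∷ 0^ (i + j) ++ M) (+-comm q 1) ⟩
    true ∷ false ∷ (0^ (q + j) ++ M)         ≡⟨ cong (λ z → true ∷ false ∷ (z ++ M)) (replicate-+ q j false) ⟩
    true ∷ false ∷ ((0^ q ++ 0^ j) ++ M)     ≡⟨ cong (λ z → true ∷ false ∷ z) (++-assoc (0^ q) (0^ j) M) ⟩
    true ∷ false ∷ (0^ q ++ 0^ j ++ M)       ∎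
  A01≡10D : A ++ false ∷ true ∷ [] ≡ true ∷ false ∷ (0^ q ++ D)
  A01≡10D = begin
    A ++ false ∷ true ∷ []                               ≡⟨ ++-assoc A _ _ ⟨
    (A ++ false ∷ []) ++ true ∷ []                       ≡⟨ cong (_++ true ∷ []) init≡A0 ⟨
    blocks (suc n) x y ++ true ∷ []                      ≡⟨ cong (_++ true ∷ []) init≡10 ⟩
    true ∷ false ∷ ((0^ q ++ 0^ j ++ M) ++ true ∷ [])    ≡⟨ cong (λ z → true ∷ false ∷ z) (++-assoc (0^ q) _ _) ⟩
    true ∷ false ∷ (0^ q ++ (0^ j ++ M) ++ true ∷ [])    ≡⟨ cong (λ z → true ∷ false ∷ (0^ q ++ z)) (++-assoc (0^ j) M _) ⟩
    true ∷ false ∷ (0^ q ++ D)                           ∎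
  f≡ : blocks (suc (suc n)) x y ≡ A ++ false ∷ true ∷ 0^ q
  f≡ = begin
    blocks (suc (suc n)) x y                                  ≡⟨ blocks-suc (suc n) x y ⟩
    blocks (suc n) x y ++ 1^ (x (suc (suc n))) ++ 0^ q        ≡⟨ cong₂ (λ w i → w ++ 1^ i ++ 0^ q) init≡A0 xₙ≡1 ⟩
    (A ++ false ∷ []) ++ true ∷ 0^ q                          ≡⟨ ++-assoc A _ _ ⟩
    A ++ false ∷ true ∷ 0^ q                                  ∎
  X Y : ℕ
  X = Σ[ 2 ⋯ suc n ] x
  Y = Σ[ 1 ⋯ suc n ] y
  -- The initial 1, not counted in `X`, balances the final zero that `A` leaves out.
  length-A : length A ≡ X + Y
  length-A = +-cancelʳ-≡ 1 _ _ (begin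
    length A + 1                   ≡⟨ length-++ A ⟨
    length (A ++ false ∷ [])       ≡⟨ cong length init≡A0 ⟨
    length (blocks (suc n) x y)    ≡⟨ length-concat-blocks x y [ 1 ⋯ suc n ] ⟩
    x 1 + X + Y                    ≡⟨ cong (λ i → i + X + Y) x₁≡1 ⟩
    1 + (X + Y)                    ≡⟨ +-comm 1 (X + Y) ⟩
    X + Y + 1                      ∎)
  length-D : length (0^ q ++ D) ≡ length A
  length-D = +-cancelˡ-≡ 2 _ _
    (trans (cong length (sym A01≡10D)) (trans (length-++ A) (+-comm (length A) 2)))
  -- For `k` = 0 the words A e e D `0^ q` have exactly the length given by the bound.
  d≡ : k + length A + (2 + (length (0^ q ++ D) + q)) ≡ 2 * X + 2 * Y + q + 2 + k
  d≡ = begin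
    k + length A + (2 + (length (0^ q ++ D) + q))   ≡⟨ cong (λ i → k + length A + (2 + (i + q))) length-D ⟩
    k + length A + (2 + (length A + q))             ≡⟨ cong (λ i → k + i + (2 + (i + q))) length-A ⟩
    k + (X + Y) + (2 + (X + Y + q))                 ≡⟨ arithmetic k X Y q ⟩
    2 * X + 2 * Y + q + 2 + k                       ∎
    where
    arithmetic : ∀ k X Y q → k + (X + Y) + (2 + (X + Y + q)) ≡ 2 * X + 2 * Y + q + 2 + k
    arithmetic = solve-∀
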